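{- Let $d\ge 1$. Every unit-interval strongly-connected $d$-dimensional simplicial complex is traceable.
   Context: A labeling of a simplicial complex with $n$ vertices is a bijection of its vertex set with $\{1,\dots,n\}$. A pure $d$-dimensional simplicial complex is strongly-connected if its dual graph is connected; the dual graph has the facets as nodes, and two facets are joined by an arc iff their intersection has cardinality $d$. Strongly-connected complexes are by convention pure. A pure $d$-dimensional simplicial complex $\Delta$ with $n$ vertices is unit-interval if there is a labeling such that for every $d$-face $F=\{a_0<a_1<\dots<a_d\}$ of $\Delta$, every $(d+1)$-element subset of $\{a_0,a_0+1,\dots,a_d\}$ is a face of $\Delta$. A $d$-dimensional simplicial complex $\Delta$ with $n$ vertices is traceable if it has a labeling such that $\{i,i+1,\dots,i+d\}\in\Delta$ for all $i=1,\dots,n-d$. -}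

module Defs where

open import Data.Bool using (_∧_)
open import Data.Fin using (Fin; toℕ) renaming (_≤_ to _≤ᶠ_)
open import Data.Fin.Permutation using (Permutation′; _⟨$⟩ʳ_)
open import Data.Fin.Subset using (Subset; _∈_; _⊆_; _∩_; ∣_∣; ⁅_⁆)
open import Data.Nat using (ℕ; suc; _+_; _≤_; _<_; _≤?_)
open import Data.Product using (_×_; ∃; ∃-syntax)
open import Data.Vec using (tabulate; lookup)
open import Relation.Binary.Construct.Closure.ReflexiveTransitive using (Star)
open import Relation.Binary.PropositionalEquality using (_≡_)
open import Relation.Nullary using (does)
open import Relation.Unary using (Decidable)

-- Every element of Fin n is required to be a vertex, so n really is the
-- number of vertices.
record SimplicialComplex (n : ℕ) : Set₁ where
  field
    Face        : Subset n → Set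
    face?       : Decidable Face
    down-closed : ∀ {F G} → G ⊆ F → Face F → Face G
    vertex      : ∀ v → Face ⁅ v ⁆

open SimplicialComplex public

private
  variable
    n : ℕ

IsFacet : SimplicialComplex n → Subset n → Set
IsFacet Δ F = Face Δ F × (∀ G → Face Δ G → F ⊆ G → F ≡ G)

HasDimension : ℕ → SimplicialComplex n → Set
HasDimension d Δ =
  (∀ F → Face Δ F → ∣ F ∣ ≤ suc d) × (∃[ F ] Face Δ F × ∣ F ∣ ≡ suc d)

Pure : ℕ → SimplicialComplex n → Set
Pure d Δ = HasDimension d Δ × (∀ F → IsFacet Δ F → ∣ F ∣ ≡ suc d)

-- The arcs are a relation on subsets rather than on Σ-types of facets:
-- IsFacet need not be proof-irrelevant, and a facet must be a single node.
DualArc : ℕ → SimplicialComplex n → Subset n → Subset n → Set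
DualArc d Δ F G = IsFacet Δ F × IsFacet Δ G × ∣ F ∩ G ∣ ≡ d

StronglyConnected : ℕ → SimplicialComplex n → Set
StronglyConnected d Δ =
  Pure d Δ × (∀ F G → IsFacet Δ F → IsFacet Δ G → Star (DualArc d Δ) F G)

-- Labels are 0, …, n - 1 instead of 1, …, n.
Labeling : ℕ → Set
Labeling n = Permutation′ n

-- The set of vertices whose label lies in S is a face.
LabeledFace : SimplicialComplex n → Labeling n → Subset n → Set
LabeledFace Δ ℓ S = Face Δ (tabulate (λ v → lookup S (ℓ ⟨$⟩ʳ v)))

-- {lo, lo + 1, …, hi}, intersected with {0, …, n - 1}.
interval : ℕ → ℕ → Subset n
interval lo hi = tabulate (λ j → does (lo ≤? toℕ j) ∧ does (toℕ j ≤? hi))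

IsMinimum : Subset n → Fin n → Set
IsMinimum S a = a ∈ S × (∀ x → x ∈ S → a ≤ᶠ x)

IsMaximum : Subset n → Fin n → Set
IsMaximum S a = a ∈ S × (∀ x → x ∈ S → x ≤ᶠ a)

-- F and G are sets of labels; a₀ and aₑ are the first and last entries
-- of F = {a₀ < a₁ < … < a_d}.
UnitInterval : ℕ → SimplicialComplex n → Set
UnitInterval {n} d Δ =
  Pure d Δ ×
  ∃ λ (ℓ : Labeling n) →
    ∀ F → LabeledFace Δ ℓ F → ∣ F ∣ ≡ suc d →
    ∀ a₀ aₑ → IsMinimum F a₀ → IsMaximum F aₑ →
    ∀ G → G ⊆ interval (toℕ a₀) (toℕ aₑ) → ∣ G ∣ ≡ suc d → LabeledFace Δ ℓ G

-- With labels starting at 0, the range 1 ≤ i ≤ n - d becomes i + d < n.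
Traceable : ℕ → SimplicialComplex n → Set
Traceable {n} d Δ =
  HasDimension d Δ ×
  ∃ λ (ℓ : Labeling n) → ∀ i → i + d < n → LabeledFace Δ ℓ (interval i (i + d))

{-# OPTIONS --safe #-}

-- The unit-interval labeling itself is a tracing.  Fix a window [i, i + d].
-- If some facet has a label ≤ i and a label ≥ i + d, the unit-interval
-- property makes the window a face.  Otherwise every facet lies entirely
-- below i + d or entirely above i.  Two facets of different kinds meet only
-- in labels strictly between i and i + d, that is, in at most d - 1 vertices,
-- so they are not adjacent in the dual graph.  By strong connectedness all
-- facets are then of one kind, although a facet through the vertex labeled i
-- is of the first kind only and a facet through i + d of the second only.
module Submission where

open import Data.Bool using (Bool; true; false; _∧_; if_then_else_)
open import Data.Bool.Properties using (T-≡; T-∧; ∧-zeroʳ)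
open import Data.Fin using (Fin; zero; suc; toℕ; fromℕ<)
open import Data.Fin.Permutation using (Permutation′; _⟨$⟩ʳ_; _⟨$⟩ˡ_; flip; inverseˡ; inverseʳ)
open import Data.Fin.Properties using (toℕ-fromℕ<)
open import Data.Fin.Subset using (Subset; _∈_; _⊆_; _⊃_; _∩_; ∣_∣; Nonempty; inside; outside)
open import Data.Fin.Subset.Induction using (⊃-wellFounded)
open import Data.Fin.Subset.Properties using (_∈?_; _⊂?_; anySubset?; nonempty?; Empty-unique; ∣⊥∣≡0; ⊆-refl; ⊆-trans; ⊆-antisym; p⊆q⇒∣p∣≤∣q∣; p⊂q⇒p⊆q; x∈⁅x⁆; x∈p∩q⁻)
open import Data.Nat using (ℕ; zero; suc; _+_; _∸_; _≤_; _<_; _≤?_; _≤ᵇ_; z≤n; s≤s)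
open import Data.Nat.Properties using (≤-trans; ≤-pred; ≤-<-trans; <-≤-trans; <-irrefl; ≰⇒>; <⇒≤; ≤⇒≤ᵇ; ≤ᵇ⇒≤; m≤m+n; 0∸n≡0; 1+n≢0; m+n∸m≡n; +-suc; +-0-commutativeMonoid; module ≤-Reasoning)
open import Data.Product using (_×_; _,_; ∃; ∃-syntax)
open import Data.Sum using (_⊎_; inj₁; inj₂)
open import Data.Vec using (_∷_; here; there; tabulate; lookup)
open import Data.Vec.Properties using (lookup∘tabulate; tabulate∘lookup; tabulate-cong; lookup⇒[]=; []=⇒lookup)
open import Function using (_∘_; Equivalence)
open import Induction.WellFounded using (Acc; acc)
open import Relation.Binary.Construct.Closure.ReflexiveTransitive using (Star; ε; _◅_)
open import Relation.Binary.PropositionalEquality using (_≡_; _≢_; refl; sym; trans; cong; cong₂; subst; module ≡-Reasoning)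
open import Relation.Nullary using (yes; no; contradiction)
open import Relation.Nullary.Decidable using (_×-dec_; decidable-stable)
open import Algebra.Properties.CommutativeMonoid.Sum +-0-commutativeMonoid using (sum; sum-permute)

open import Defs

private
  variable
    n : ℕ

∈-tabulate⁺ : ∀ {f : Fin n → Bool} {x} → f x ≡ true → x ∈ tabulate f
∈-tabulate⁺ {f = f} {x} fx = lookup⇒[]= x _ (trans (lookup∘tabulate f x) fx)

∈-tabulate⁻ : ∀ {f : Fin n → Bool} {x} → x ∈ tabulate f → f x ≡ true
∈-tabulate⁻ {f = f} {x} x∈ = trans (sym (lookup∘tabulate f x)) ([]=⇒lookup x∈)

∣p∣≢0⇒nonempty : ∀ {p : Subset n} → ∣ p ∣ ≢ 0 → Nonempty p
∣p∣≢0⇒nonempty {n} {p} ∣p∣≢0 = decidable-stable (nonempty? p)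
  λ empty → ∣p∣≢0 (trans (cong ∣_∣ (Empty-unique empty)) (∣⊥∣≡0 n))

minimum : ∀ (p : Subset n) → Nonempty p → ∃ (IsMinimum p)
minimum (inside  ∷ p) _                    = zero , here , λ _ _ → z≤n
minimum (outside ∷ p) (suc x , there x∈p) with minimum p (x , x∈p)
... | a , a∈p , a≤ = suc a , there a∈p , λ { (suc y) (there y∈p) → s≤s (a≤ y y∈p) }

maximum : ∀ (p : Subset n) → Nonempty p → ∃ (IsMaximum p)
maximum (s ∷ p) ne with nonempty? p
... | yes ne′ with maximum p ne′
...   | a , a∈p , ≤a = suc a , there a∈p ,
        λ { zero _ → z≤n ; (suc y) (there y∈p) → s≤s (≤a y y∈p) }
maximum (s ∷ p) (suc x , there x∈p) | no empty = contradiction (x , x∈p) empty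
maximum (s ∷ p) (zero , here)       | no empty = zero , here ,
  λ { zero _ → z≤n ; (suc y) (there y∈p) → contradiction (y , y∈p) empty }

∈-interval⁺ : ∀ {lo hi} {x : Fin n} → lo ≤ toℕ x → toℕ x ≤ hi → x ∈ interval lo hi
∈-interval⁺ lo≤x x≤hi = ∈-tabulate⁺
  -- `does (m ≤? n)` computes to `m ≤ᵇ n`, so the Boolean tests inside `interval` are met by `≤⇒≤ᵇ`.
  (cong₂ _∧_ (Equivalence.to T-≡ (≤⇒≤ᵇ lo≤x)) (Equivalence.to T-≡ (≤⇒≤ᵇ x≤hi)))

∈-interval⁻ : ∀ {lo hi} {x : Fin n} → x ∈ interval lo hi → lo ≤ toℕ x × toℕ x ≤ hi
∈-interval⁻ {lo = lo} {hi} {x} x∈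
  with l , h ← Equivalence.to T-∧ (Equivalence.from T-≡ (∈-tabulate⁻ x∈))
  = ≤ᵇ⇒≤ lo (toℕ x) l , ≤ᵇ⇒≤ (toℕ x) hi h

interval-mono : ∀ {lo lo′ hi hi′} → lo′ ≤ lo → hi ≤ hi′ → interval {n} lo hi ⊆ interval lo′ hi′
interval-mono lo′≤lo hi≤hi′ x∈ with lo≤x , x≤hi ← ∈-interval⁻ x∈ =
  ∈-interval⁺ (≤-trans lo′≤lo lo≤x) (≤-trans x≤hi hi≤hi′)

∣tabulate-outside∣≡0 : ∀ n {f : Fin n → Bool} → (∀ x → f x ≡ false) → ∣ tabulate f ∣ ≡ 0
∣tabulate-outside∣≡0 zero    f≡false = refl
∣tabulate-outside∣≡0 (suc n) f≡false rewrite f≡false zero = ∣tabulate-outside∣≡0 n (f≡false ∘ suc)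

-- `_≤ᵇ_` computes through `_<ᵇ_`, so both sides reduce to the same term only after a split on `m`.
suc-≤ᵇ-suc : ∀ m k → (suc m ≤ᵇ suc k) ≡ (m ≤ᵇ k)
suc-≤ᵇ-suc zero    k = refl
suc-≤ᵇ-suc (suc m) k = refl

-- Induction removes label 0 and shifts both ends down; `hi < n` keeps the interval from being cut
-- off at the top. Truncated subtraction also gives 0 for an empty interval, the case `k = 0` of the
-- adjacency bound below.
∣interval∣≡1+hi∸lo : ∀ n lo hi → hi < n → ∣ interval {n} lo hi ∣ ≡ suc hi ∸ lo
∣interval∣≡1+hi∸lo (suc n) zero zero _ = cong suc (∣tabulate-outside∣≡0 n λ _ → refl)
∣interval∣≡1+hi∸lo (suc n) zero (suc hi) (s≤s hi<n) = cong suc (trans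
  (cong ∣_∣ (tabulate-cong λ (x : Fin n) → suc-≤ᵇ-suc (toℕ x) hi))
  (∣interval∣≡1+hi∸lo n zero hi hi<n))
∣interval∣≡1+hi∸lo (suc n) (suc lo) zero _ = trans
  (∣tabulate-outside∣≡0 n λ _ → ∧-zeroʳ _)
  (sym (0∸n≡0 lo))
∣interval∣≡1+hi∸lo (suc n) (suc lo) (suc hi) (s≤s hi<n) = trans
  (cong ∣_∣ (tabulate-cong λ (x : Fin n) → cong₂ _∧_ (suc-≤ᵇ-suc lo (toℕ x)) (suc-≤ᵇ-suc (toℕ x) hi)))
  (∣interval∣≡1+hi∸lo n lo hi hi<n)

-- Spelled so that `LabeledFace Δ ℓ S` is `Face Δ (preimage ℓ S)` by definition.
preimage : Permutation′ n → Subset n → Subset n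
preimage π p = tabulate (λ x → lookup p (π ⟨$⟩ʳ x))

∈-preimage⁺ : ∀ (π : Permutation′ n) {p x} → π ⟨$⟩ʳ x ∈ p → x ∈ preimage π p
∈-preimage⁺ π = ∈-tabulate⁺ ∘ []=⇒lookup

preimage-preimage-flip : ∀ (π : Permutation′ n) p → preimage π (preimage (flip π) p) ≡ p
preimage-preimage-flip π p = trans
  (tabulate-cong λ x → trans (lookup∘tabulate _ (π ⟨$⟩ʳ x)) (cong (lookup p) (inverseˡ π)))
  (tabulate∘lookup p)

indicator : Bool → ℕ
indicator b = if b then 1 else 0

∣tabulate∣≡sum : ∀ (f : Fin n → Bool) → ∣ tabulate f ∣ ≡ sum (indicator ∘ f)
∣tabulate∣≡sum {zero}  f = refl
∣tabulate∣≡sum {suc n} f with f zero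
... | true  = cong suc (∣tabulate∣≡sum (f ∘ suc))
... | false = ∣tabulate∣≡sum (f ∘ suc)

-- As a sum of 0/1 indicators, cardinality is invariant under reindexing by a permutation.
∣preimage∣ : ∀ (π : Permutation′ n) p → ∣ preimage π p ∣ ≡ ∣ p ∣
∣preimage∣ π p = begin
  ∣ preimage π p ∣                            ≡⟨ ∣tabulate∣≡sum (λ x → lookup p (π ⟨$⟩ʳ x)) ⟩
  sum (λ x → indicator (lookup p (π ⟨$⟩ʳ x))) ≡⟨ sum-permute (indicator ∘ lookup p) π ⟨
  sum (indicator ∘ lookup p)                  ≡⟨ ∣tabulate∣≡sum (lookup p) ⟨
  ∣ tabulate (lookup p) ∣                     ≡⟨ cong ∣_∣ (tabulate∘lookup p) ⟩
  ∣ p ∣                                       ∎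
  where open ≡-Reasoning

-- Strictly growing subsets of a finite set must stop, and `face?` makes the search for a larger
-- face decidable at each stage.
face⊆facet : ∀ (Δ : SimplicialComplex n) F → Face Δ F → ∃[ G ] IsFacet Δ G × F ⊆ G
face⊆facet Δ F = extend F (⊃-wellFounded F)
  where
  extend : ∀ F → Acc _⊃_ F → Face Δ F → ∃[ G ] IsFacet Δ G × F ⊆ G
  extend F (acc rec) F∈Δ with anySubset? (λ G → face? Δ G ×-dec F ⊂? G)
  ... | yes (G , G∈Δ , F⊂G) with H , H-facet , G⊆H ← extend G (rec F⊂G) G∈Δ =
    H , H-facet , ⊆-trans (p⊂q⇒p⊆q F⊂G) G⊆H
  ... | no maximal = F , (F∈Δ , unique) , ⊆-refl
    where
    unique : ∀ G → Face Δ G → F ⊆ G → F ≡ G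
    unique G G∈Δ F⊆G = ⊆-antisym F⊆G λ {x} x∈G → decidable-stable (x ∈? F)
      λ x∉F → maximal (G , G∈Δ , F⊆G , x , x∈G , x∉F)

facet-through : ∀ (Δ : SimplicialComplex n) v → ∃[ F ] IsFacet Δ F × v ∈ F
facet-through Δ v with F , F-facet , v⊆F ← face⊆facet Δ _ (vertex Δ v) =
  F , F-facet , v⊆F (x∈⁅x⁆ v)

theorem3 : (d : ℕ) → 1 ≤ d → (n : ℕ) → (Δ : SimplicialComplex n) → UnitInterval d Δ → StronglyConnected d Δ → Traceable d Δ
theorem3 (suc k) _ n Δ (_ , ℓ , unit-interval) ((hasDim , pure) , connected) =
  hasDim , ℓ , window-face
  where
  d : ℕ
  d = suc k

  label : Fin n → ℕ
  label v = toℕ (ℓ ⟨$⟩ʳ v)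

  Below Above : ℕ → Subset n → Set
  Below i F = ∀ {v} → v ∈ F → label v < i
  Above i F = ∀ {v} → v ∈ F → i < label v

  vertex-labeled : ∀ j → j < n → ∃[ v ] label v ≡ j
  vertex-labeled j j<n = ℓ ⟨$⟩ˡ fromℕ< j<n , trans (cong toℕ (inverseʳ ℓ)) (toℕ-fromℕ< j<n)

  module _ (i : ℕ) (i+d<n : i + d < n) where

    Window : Set
    Window = LabeledFace Δ ℓ (interval i (i + d))

    ∣window∣ : ∣ interval {n} i (i + d) ∣ ≡ suc d
    ∣window∣ = trans (∣interval∣≡1+hi∸lo n i (i + d) i+d<n)
      (trans (cong (_∸ i) (sym (+-suc i d))) (m+n∸m≡n i (suc d)))

    -- Decided by comparing the least label of `F` with `i` and the greatest with `i + d`. `Window`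
    -- is one of the outcomes, so a spanning facet met anywhere ends the argument.
    classify : ∀ F → IsFacet Δ F → Window ⊎ Below (i + d) F ⊎ Above i F
    classify F facet@(F∈Δ , _) = split
      where
      -- The image of `F` under `ℓ`, as a preimage along the inverse, so that `∣preimage∣` gives its
      -- size.
      labels : Subset n
      labels = preimage (flip ℓ) F

      ∣labels∣ : ∣ labels ∣ ≡ suc d
      ∣labels∣ = trans (∣preimage∣ (flip ℓ) F) (pure F facet)

      labels-nonempty : Nonempty labels
      labels-nonempty = ∣p∣≢0⇒nonempty λ ∣labels∣≡0 → 1+n≢0 (trans (sym ∣labels∣) ∣labels∣≡0)

      label∈labels : ∀ {v} → v ∈ F → ℓ ⟨$⟩ʳ v ∈ labels
      label∈labels v∈F = ∈-preimage⁺ (flip ℓ) (subst (_∈ F) (sym (inverseˡ ℓ)) v∈F)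

      split : Window ⊎ Below (i + d) F ⊎ Above i F
      split
        with a , a-min@(_ , a≤) ← minimum labels labels-nonempty
           | b , b-max@(_ , ≤b) ← maximum labels labels-nonempty
        with toℕ a ≤? i | i + d ≤? toℕ b
      ... | no a≰i | _ = inj₂ (inj₂ λ v∈F → <-≤-trans (≰⇒> a≰i) (a≤ _ (label∈labels v∈F)))
      ... | yes _ | no i+d≰b = inj₂ (inj₁ λ v∈F → ≤-<-trans (≤b _ (label∈labels v∈F)) (≰⇒> i+d≰b))
      -- `unit-interval` takes sets of labels; pulling `labels` back along `ℓ` returns the face `F`.
      ... | yes a≤i | yes i+d≤b = inj₁ (unit-interval labels
        (subst (Face Δ) (sym (preimage-preimage-flip ℓ F)) F∈Δ) ∣labels∣
        a b a-min b-max _ (interval-mono a≤i i+d≤b) ∣window∣)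

    -- The labels strictly between `i` and `i + d` run from `suc i` to `i + k`; there are only `k`
    -- of them, one short of `d = suc k`.
    below-above-not-adjacent : ∀ {F G} → Below (i + d) F → Above i G → ∣ F ∩ G ∣ ≢ d
    below-above-not-adjacent {F} {G} below above ∣F∩G∣≡d = <-irrefl refl (begin
      suc k                                      ≡⟨ ∣F∩G∣≡d ⟨
      ∣ F ∩ G ∣                                  ≤⟨ p⊆q⇒∣p∣≤∣q∣ F∩G⊆interior ⟩
      ∣ preimage ℓ (interval (suc i) (i + k)) ∣  ≡⟨ ∣preimage∣ ℓ (interval (suc i) (i + k)) ⟩
      ∣ interval {n} (suc i) (i + k) ∣           ≡⟨ ∣interval∣≡1+hi∸lo n (suc i) (i + k) i+k<n ⟩
      -- `suc (i + k) ∸ suc i` has already computed to `i + k ∸ i`.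
      i + k ∸ i                                  ≡⟨ m+n∸m≡n i k ⟩
      k                                          ∎)
      where
      open ≤-Reasoning

      i+k<n : i + k < n
      i+k<n = <⇒≤ (subst (_< n) (+-suc i k) i+d<n)

      F∩G⊆interior : F ∩ G ⊆ preimage ℓ (interval (suc i) (i + k))
      F∩G⊆interior {v} v∈F∩G with v∈F , v∈G ← x∈p∩q⁻ F G v∈F∩G = ∈-preimage⁺ ℓ
        (∈-interval⁺ (above v∈G) (≤-pred (subst (label v <_) (+-suc i k) (below v∈F))))

    -- Each arc of the path leads to a facet that is classified afresh; adjacency to a `Below` facet
    -- excludes `Above`, so the induction carries `Below` alone until a window appears or the path
    -- ends.
    below-propagates : ∀ {F G} → Star (DualArc d Δ) F G → Below (i + d) F → Window ⊎ Below (i + d) G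
    below-propagates ε below = inj₂ below
    below-propagates ((_ , F′-facet , ∣F∩F′∣≡d) ◅ path) below with classify _ F′-facet
    ... | inj₁ window         = inj₁ window
    ... | inj₂ (inj₁ below′) = below-propagates path below′
    ... | inj₂ (inj₂ above′) = contradiction ∣F∩F′∣≡d (below-above-not-adjacent below above′)

    window-face : Window
    window-face
      with v , ℓv≡i ← vertex-labeled i (≤-<-trans (m≤m+n i d) i+d<n)
         | w , ℓw≡i+d ← vertex-labeled (i + d) i+d<n
      with F , F-facet , v∈F ← facet-through Δ v
         | G , G-facet , w∈G ← facet-through Δ w
      with classify F F-facet
    ... | inj₁ window        = window
    ... | inj₂ (inj₂ above) = contradiction (above v∈F) (<-irrefl (sym ℓv≡i))
    ... | inj₂ (inj₁ below) with below-propagates (connected F G F-facet G-facet) below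
    ...   | inj₁ window  = window
    ...   | inj₂ below′ = contradiction (below′ w∈G) (<-irrefl ℓw≡i+d)
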